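{- For every well-formed term $\varphi$: $\emptyset\vdash\varphi$ is derivable in OGA if and only if $\varphi$ is super-true.
   Context: **Syntax.** Terms: $t::=v_i\mid\bot\mid\mathbf 0\mid\mathbf S t\mid t=t\mid\neg t\mid t\lor t\mid\lambda t\mid t\cdot t\mid\mathcal R\mid\mathcal A$ ($v_i$, $i\in\mathbb N$, de Bruijn variables; $\lambda$ is the only binder; application associates to the left). A term is well-formed (wf) if generated by this grammar. $\bot$ is a divergent constant, $\mathcal R$ the primitive recursor, $\mathcal A$ the universal quantifier. Abbreviations: $t\,\mathsf N$ is $t=t$; $t\,\mathsf B$ is $t\lor\neg t$; $t\ne u$ is $\neg(t=u)$; $t\land u$ is $\neg(\neg t\lor\neg u)$; $t\to u$ is $\neg t\lor u$; $\underline n=\mathbf S^n\mathbf 0$. $\uparrow$ shifts all free indices up by one; $b[t]$ is the $\beta$-instance substituting $t$ for the outermost bound variable of $b$; $[v\mapsto s]$ is capture-avoiding substitution for a free variable; $\mathrm{fv}$ is the set of free variables. **Head steps** $\triangleright$: $(\lambda b)\cdot t\triangleright b[t]$; $\mathcal R\cdot g\cdot h\cdot\mathbf 0\triangleright g$; $\mathcal R\cdot g\cdot h\cdot(\mathbf S\underline n)\triangleright h\cdot\underline n\cdot(\mathcal R\cdot g\cdot h\cdot\underline n)$; if $t\triangleright t'$ then $t\cdot u\triangleright t'\cdot u$. **Rules.** Judgments are $\Gamma\vdash c$, $\Gamma$ a finite set of wf terms, $c$ a wf term (all terms in rules are wf). A proof is a finite list of judgments each following from earlier entries by one rule; $\Gamma\vdash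 c$ is derivable if it occurs in a proof. Rules ("$\Rightarrow$" from premises to conclusion, "$\Leftrightarrow$" both directions; $\Gamma$ is the context of a judgment when none is shown): $\Gamma,c\vdash c$; $\Gamma\vdash c\Rightarrow\Gamma,a\vdash c$; $\Gamma\vdash a$ and $\Gamma,a\vdash c\Rightarrow\Gamma\vdash c$; $\Gamma\vdash c\Rightarrow[v\mapsto s]\Gamma\vdash[v\mapsto s]c$; $\vdash a\Leftrightarrow\ \vdash a=\underline1$; $\vdash\neg a\Leftrightarrow\ \vdash a=\underline0$; $\vdash\neg a,\ \vdash a\Rightarrow\ \vdash c$; $\vdash a\Leftrightarrow\ \vdash\neg\neg a$; $\vdash a\Rightarrow\ \vdash a\lor b$; $\vdash b\Rightarrow\ \vdash a\lor b$; $\vdash\neg a,\ \vdash\neg b\Rightarrow\ \vdash\neg(a\lor b)$; $\vdash a\lor b,\ \Gamma,a\vdash c,\ \Gamma,b\vdash c\Rightarrow\ \vdash c$; $\vdash\neg(a\lor b)\Rightarrow\ \vdash\neg a$; $\vdash\neg(a\lor b)\Rightarrow\ \vdash\neg b$; $\vdash a\,\mathsf N\Leftrightarrow\ \vdash a=a$; $\vdash a=b\Rightarrow\ \vdash b=a$; $\vdash a=b,\ \vdash[v\mapsto a]p\Rightarrow\ \vdash[v\mapsto b]p$; $\vdash a\ne b\Rightarrow\ \vdash b\ne a$; $\vdash a\,\mathsf N,\ \vdash b\,\mathsf N\Rightarrow\ \vdash(a=b)\,\mathsf B$; $\vdash(a=b)\,\mathsf B\Rightarrow\ \vdash(a\,\mathsf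 N)\land(b\,\mathsf N)$; $\vdash\mathbf 0\,\mathsf N$; $\vdash a\,\mathsf N\Leftrightarrow\ \vdash(\mathbf S a)\,\mathsf N$; $\vdash a\,\mathsf N\Rightarrow\ \vdash\mathbf S a\ne\mathbf 0$; $\vdash a\ne b\Leftrightarrow\ \vdash\mathbf S a\ne\mathbf S b$; $\vdash\mathbf S a=\mathbf S b\Rightarrow\ \vdash a=b$; $\vdash\bot\,\mathsf N\Rightarrow\ \vdash p$; induction: $\vdash[v_i\mapsto\mathbf 0]c$, $\ v_i\,\mathsf N,c,\Gamma\vdash[v_i\mapsto\mathbf S v_i]c$, $\ \vdash a\,\mathsf N\Rightarrow\ \vdash[v_i\mapsto a]c$ if $v_i\notin\mathrm{fv}(\Gamma)$; conversion, for $c\triangleright c'$: $\vdash c'\Rightarrow\ \vdash c$; $\vdash c\Rightarrow\ \vdash c'$; $\vdash\neg c\Rightarrow\ \vdash\neg c'$; $\vdash c'\,\mathsf N\Rightarrow\ \vdash c=c'$; $\vdash m\,\mathsf N,\ \vdash(h\cdot m\cdot(\mathcal R\cdot g\cdot h\cdot m))\,\mathsf N\Rightarrow\ \vdash\mathcal R\cdot g\cdot h\cdot(\mathbf S m)=h\cdot m\cdot(\mathcal R\cdot g\cdot h\cdot m)$; $v_0\,\mathsf N,\uparrow\Gamma\vdash\uparrow f\cdot v_0\Rightarrow\Gamma\vdash\mathcal A\cdot f$; $\vdash\mathcal A\cdot f,\ \vdash a\,\mathsf N\Rightarrow\ \vdash f\cdot a$; $\vdash\neg(f\cdot a),\ \vdash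 a\,\mathsf N\Rightarrow\ \vdash\neg(\mathcal A\cdot f)$; $\Gamma\vdash\neg(\mathcal A\cdot f)$ and $v_0\,\mathsf N,\neg(\uparrow f\cdot v_0),\uparrow\Gamma\vdash\uparrow c\Rightarrow\Gamma\vdash c$. These are the rules of RGA. OGA has these and the rule ATI: $\Gamma\vdash\mathcal A\cdot(\lambda((\uparrow u\cdot v_0)\,\mathsf B))\Rightarrow\Gamma\vdash(\mathcal A\cdot u)\,\mathsf B$. Below $\vdash$ is OGA-derivability. **Fafi values.** A universal $\mathcal A\cdot u$ is certified if $\emptyset\vdash\mathcal A\cdot(\lambda((\uparrow u\cdot v_0)\,\mathsf B))$. For each certified $\mathcal A\cdot u$ there is an atom $x_{\mathcal A\cdot u}$. Values are elements of the free Boolean algebra on these atoms, with constants $\top$ (true) and $\mathsf F$ (false). Evaluation $\varphi\rightsquigarrow p$ ("$p$ is a value of $\varphi$") is the least relation between terms and values with: $\varphi\rightsquigarrow\top$ if $\emptyset\vdash\varphi$; $\varphi\rightsquigarrow\mathsf F$ if $\emptyset\vdash\neg\varphi$; $\varphi\rightsquigarrow p$ implies $\neg\varphi\rightsquigarrow\neg p$; $\varphi\rightsquigarrow p$, $\psi\rightsquigarrow q$ imply $\varphi\lor\psi\rightsquigarrow p\lor q$; $\mathcal A\cdot u\rightsquigarrow x_{\mathcal A\cdot u}$ if $\mathcal A\cdot u$ is certified. **Super-truth.** A valuation $w$ assigns a truth value to every atom (extended homomorphically to values). A finite set $\Delta$ of terms is honest for $w$ if each member is either a certified $\mathcal A\cdot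 u$ with $w(x_{\mathcal A\cdot u})$ true, or $\neg(\mathcal A\cdot u)$ with $\mathcal A\cdot u$ certified and $w(x_{\mathcal A\cdot u})$ false. $w$ is admissible if for no $\Delta$ honest for $w$ is there a term $c$ with $\Delta\vdash c$ and $\Delta\vdash\neg c$. $\varphi$ is super-true if it has a value $p$ such that $w(p)$ is true for every admissible $w$. -}

module Defs where

open import Algebra.Lattice.Bundles using (BooleanAlgebra)
open import Algebra.Lattice.Structures.Biased
  using (isBooleanAlgebraʳ; isDistributiveLatticeʳʲᵐ)
open import Data.Bool.Base using (Bool; true; false; not; _∨_; _∧_)
import Data.Bool.Properties as Bool
open import Data.List.Base using (List; []; _∷_; map)
open import Data.List.Membership.Propositional using (_∈_)
open import Data.List.Relation.Binary.BagAndSetEquality using (_∼[_]_; set)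
open import Data.List.Relation.Unary.All using (All)
open import Data.Nat.Base using (ℕ; zero; suc)
open import Data.Nat.Properties using (_≟_)
open import Data.Product.Base using (∃-syntax; _×_; _,_)
open import Function.Base using (_∘_)
open import Level using (0ℓ)
open import Relation.Binary.PropositionalEquality
  using (_≡_; refl; sym; trans; cong; cong₂)
open import Relation.Nullary.Decidable.Core using (does)
open import Relation.Nullary.Negation.Core using (¬_)
open import Relation.Unary using (Pred; ∅; _∪_; ｛_｝)

------------------------------------------------------------------------
-- Terms

infixl 9 _·_
infixr 8 𝐒_
infix  7 _≐_ _≠_ _𝖭
infixr 6 ~_
infixl 5 _⋎_ _⋏_
infix  5 _𝖡
infixr 4 ƛ_

data Term : Set where
  v      : ℕ → Term
  bot    : Term
  𝟎      : Term
  𝐒_     : Term → Term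
  _≐_    : Term → Term → Term
  ~_     : Term → Term
  _⋎_    : Term → Term → Term
  ƛ_     : Term → Term
  _·_    : Term → Term → Term
  𝓡      : Term
  𝓐      : Term

_𝖭 _𝖡 : Term → Term
t 𝖭 = t ≐ t
t 𝖡 = t ⋎ ~ t

_≠_ _⋏_ : Term → Term → Term
t ≠ u = ~ (t ≐ u)
t ⋏ u = ~ (~ t ⋎ ~ u)

numeral : ℕ → Term
numeral zero    = 𝟎
numeral (suc n) = 𝐒 numeral n

------------------------------------------------------------------------
-- Renaming and substitution

lift : (ℕ → ℕ) → ℕ → ℕ
lift ρ zero    = zero
lift ρ (suc i) = suc (ρ i)

rename : (ℕ → ℕ) → Term → Term
rename ρ (v i)   = v (ρ i)
rename ρ bot     = bot
rename ρ 𝟎       = 𝟎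
rename ρ (𝐒 t)   = 𝐒 rename ρ t
rename ρ (t ≐ u) = rename ρ t ≐ rename ρ u
rename ρ (~ t)   = ~ rename ρ t
rename ρ (t ⋎ u) = rename ρ t ⋎ rename ρ u
rename ρ (ƛ b)   = ƛ rename (lift ρ) b
rename ρ (t · u) = rename ρ t · rename ρ u
rename ρ 𝓡       = 𝓡
rename ρ 𝓐       = 𝓐

↑ : Term → Term
↑ = rename suc

lifts : (ℕ → Term) → ℕ → Term
lifts σ zero    = v zero
lifts σ (suc i) = ↑ (σ i)

subst : (ℕ → Term) → Term → Term
subst σ (v i)   = σ i
subst σ bot     = bot
subst σ 𝟎       = 𝟎
subst σ (𝐒 t)   = 𝐒 subst σ t
subst σ (t ≐ u) = subst σ t ≐ subst σ u
subst σ (~ t)   = ~ subst σ t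
subst σ (t ⋎ u) = subst σ t ⋎ subst σ u
subst σ (ƛ b)   = ƛ subst (lifts σ) b
subst σ (t · u) = subst σ t · subst σ u
subst σ 𝓡       = 𝓡
subst σ 𝓐       = 𝓐

-- Removes the binder: the other free indices of the body drop by one.
infix 10 _⟨_⟩
_⟨_⟩ : Term → Term → Term
b ⟨ t ⟩ = subst (λ where zero → t ; (suc i) → v i) b

-- Replaces a free variable and leaves every other index unchanged.
single : ℕ → Term → ℕ → Term
single i s j with does (j ≟ i)
... | true  = s
... | false = v j

infixr 9 [_↦_]_
[_↦_]_ : ℕ → Term → Term → Term
[ i ↦ s ] t = subst (single i s) t

fv : Term → Pred ℕ 0ℓ
fv (v i)   = ｛ i ｝
fv bot     = ∅
fv 𝟎       = ∅
fv (𝐒 t)   = fv t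
fv (t ≐ u) = fv t ∪ fv u
fv (~ t)   = fv t
fv (t ⋎ u) = fv t ∪ fv u
fv (ƛ b)   = fv b ∘ suc
fv (t · u) = fv t ∪ fv u
fv 𝓡       = ∅
fv 𝓐       = ∅

------------------------------------------------------------------------
-- Head steps

infix 3 _▷_
data _▷_ : Term → Term → Set where
  beta : ∀ {b t} → (ƛ b) · t ▷ b ⟨ t ⟩
  rec0 : ∀ {g h} → 𝓡 · g · h · 𝟎 ▷ g
  recS : ∀ {g h} n →
         𝓡 · g · h · (𝐒 numeral n) ▷ h · numeral n · (𝓡 · g · h · numeral n)
  appˡ : ∀ {t t′ u} → t ▷ t′ → t · u ▷ t′ · u

------------------------------------------------------------------------
-- Judgments, rules and proofs

-- A list stands for the finite set of its members: `reset` below makes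
-- derivability depend only on that set.
Ctx : Set
Ctx = List Term

infix 2 _⊢_
record Judgment : Set where
  constructor _⊢_
  field
    context    : Ctx
    conclusion : Term

-- The first argument is the list of premises.
Rules : Set₁
Rules = List Judgment → Judgment → Set

private variable
  Γ Δ               : Ctx
  a b c c′ f g h m p s u : Term
  i                 : ℕ

data RGA : Rules where
  reset    : Γ ∼[ set ] Δ → RGA ((Γ ⊢ c) ∷ []) (Δ ⊢ c)

  hyp      : RGA [] (c ∷ Γ ⊢ c)
  weaken   : RGA ((Γ ⊢ c) ∷ []) (a ∷ Γ ⊢ c)
  cut      : RGA ((Γ ⊢ a) ∷ (a ∷ Γ ⊢ c) ∷ []) (Γ ⊢ c)
  inst     : RGA ((Γ ⊢ c) ∷ []) (map ([ i ↦ s ]_) Γ ⊢ [ i ↦ s ] c)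

  true-I   : RGA ((Γ ⊢ a) ∷ []) (Γ ⊢ a ≐ numeral 1)
  true-E   : RGA ((Γ ⊢ a ≐ numeral 1) ∷ []) (Γ ⊢ a)
  false-I  : RGA ((Γ ⊢ ~ a) ∷ []) (Γ ⊢ a ≐ numeral 0)
  false-E  : RGA ((Γ ⊢ a ≐ numeral 0) ∷ []) (Γ ⊢ ~ a)

  ~-E      : RGA ((Γ ⊢ ~ a) ∷ (Γ ⊢ a) ∷ []) (Γ ⊢ c)
  ~~-I     : RGA ((Γ ⊢ a) ∷ []) (Γ ⊢ ~ ~ a)
  ~~-E     : RGA ((Γ ⊢ ~ ~ a) ∷ []) (Γ ⊢ a)

  ⋎-I₁     : RGA ((Γ ⊢ a) ∷ []) (Γ ⊢ a ⋎ b)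
  ⋎-I₂     : RGA ((Γ ⊢ b) ∷ []) (Γ ⊢ a ⋎ b)
  ~⋎-I     : RGA ((Γ ⊢ ~ a) ∷ (Γ ⊢ ~ b) ∷ []) (Γ ⊢ ~ (a ⋎ b))
  ⋎-E      : RGA ((Γ ⊢ a ⋎ b) ∷ (a ∷ Γ ⊢ c) ∷ (b ∷ Γ ⊢ c) ∷ []) (Γ ⊢ c)
  ~⋎-E₁    : RGA ((Γ ⊢ ~ (a ⋎ b)) ∷ []) (Γ ⊢ ~ a)
  ~⋎-E₂    : RGA ((Γ ⊢ ~ (a ⋎ b)) ∷ []) (Γ ⊢ ~ b)

  -- a 𝖭 abbreviates a ≐ a, so these two do nothing.
  𝖭⇒≐      : RGA ((Γ ⊢ a 𝖭) ∷ []) (Γ ⊢ a ≐ a)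
  ≐⇒𝖭      : RGA ((Γ ⊢ a ≐ a) ∷ []) (Γ ⊢ a 𝖭)
  ≐-sym    : RGA ((Γ ⊢ a ≐ b) ∷ []) (Γ ⊢ b ≐ a)
  ≐-E      : RGA ((Γ ⊢ a ≐ b) ∷ (Γ ⊢ [ i ↦ a ] p) ∷ []) (Γ ⊢ [ i ↦ b ] p)
  ≠-sym    : RGA ((Γ ⊢ a ≠ b) ∷ []) (Γ ⊢ b ≠ a)
  ≐𝖡-I     : RGA ((Γ ⊢ a 𝖭) ∷ (Γ ⊢ b 𝖭) ∷ []) (Γ ⊢ (a ≐ b) 𝖡)
  ≐𝖡-E     : RGA ((Γ ⊢ (a ≐ b) 𝖡) ∷ []) (Γ ⊢ (a 𝖭) ⋏ (b 𝖭))

  𝟎-𝖭      : RGA [] (Γ ⊢ 𝟎 𝖭)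
  𝐒-𝖭-I    : RGA ((Γ ⊢ a 𝖭) ∷ []) (Γ ⊢ (𝐒 a) 𝖭)
  𝐒-𝖭-E    : RGA ((Γ ⊢ (𝐒 a) 𝖭) ∷ []) (Γ ⊢ a 𝖭)
  𝐒≠𝟎      : RGA ((Γ ⊢ a 𝖭) ∷ []) (Γ ⊢ 𝐒 a ≠ 𝟎)
  𝐒≠-I     : RGA ((Γ ⊢ a ≠ b) ∷ []) (Γ ⊢ 𝐒 a ≠ 𝐒 b)
  𝐒≠-E     : RGA ((Γ ⊢ 𝐒 a ≠ 𝐒 b) ∷ []) (Γ ⊢ a ≠ b)
  𝐒-inj    : RGA ((Γ ⊢ 𝐒 a ≐ 𝐒 b) ∷ []) (Γ ⊢ a ≐ b)
  bot-E    : RGA ((Γ ⊢ bot 𝖭) ∷ []) (Γ ⊢ p)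

  ind      : All (λ t → ¬ fv t i) Γ →
             RGA ( (Γ ⊢ [ i ↦ 𝟎 ] c)
                 ∷ (v i 𝖭 ∷ c ∷ Γ ⊢ [ i ↦ 𝐒 v i ] c)
                 ∷ (Γ ⊢ a 𝖭)
                 ∷ [])
                 (Γ ⊢ [ i ↦ a ] c)

  expand   : c ▷ c′ → RGA ((Γ ⊢ c′) ∷ []) (Γ ⊢ c)
  reduce   : c ▷ c′ → RGA ((Γ ⊢ c) ∷ []) (Γ ⊢ c′)
  ~-reduce : c ▷ c′ → RGA ((Γ ⊢ ~ c) ∷ []) (Γ ⊢ ~ c′)
  ▷⇒≐      : c ▷ c′ → RGA ((Γ ⊢ c′ 𝖭) ∷ []) (Γ ⊢ c ≐ c′)

  𝓡-𝐒      : RGA ((Γ ⊢ m 𝖭) ∷ (Γ ⊢ (h · m · (𝓡 · g · h · m)) 𝖭) ∷ [])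
                 (Γ ⊢ 𝓡 · g · h · (𝐒 m) ≐ h · m · (𝓡 · g · h · m))

  𝓐-I      : RGA ((v 0 𝖭 ∷ map ↑ Γ ⊢ ↑ f · v 0) ∷ []) (Γ ⊢ 𝓐 · f)
  𝓐-E      : RGA ((Γ ⊢ 𝓐 · f) ∷ (Γ ⊢ a 𝖭) ∷ []) (Γ ⊢ f · a)
  ~𝓐-I     : RGA ((Γ ⊢ ~ (f · a)) ∷ (Γ ⊢ a 𝖭) ∷ []) (Γ ⊢ ~ (𝓐 · f))
  ~𝓐-E     : RGA ( (Γ ⊢ ~ (𝓐 · f))
                 ∷ (v 0 𝖭 ∷ ~ (↑ f · v 0) ∷ map ↑ Γ ⊢ ↑ c)
                 ∷ [])
                 (Γ ⊢ c)

data OGA : Rules where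
  rga : ∀ {js j} → RGA js j → OGA js j
  ATI : OGA ((Γ ⊢ 𝓐 · (ƛ (↑ u · v 0) 𝖡)) ∷ []) (Γ ⊢ (𝓐 · u) 𝖡)

-- Newest entry first.
data Proof (R : Rules) : List Judgment → Set where
  []   : Proof R []
  step : ∀ {π ps j} → Proof R π → All (_∈ π) ps → R ps j → Proof R (j ∷ π)

Derivable : Rules → Judgment → Set
Derivable R j = ∃[ π ] Proof R π × j ∈ π

infix 2 _⊢ᴼ_
_⊢ᴼ_ : Ctx → Term → Set
Γ ⊢ᴼ c = Derivable OGA (Γ ⊢ c)

------------------------------------------------------------------------
-- Values

Certified : Term → Set
Certified u = [] ⊢ᴼ 𝓐 · (ƛ (↑ u · v 0) 𝖡)

-- The atom of 𝓐 · body.  Irrelevance of the certificate gives one atom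
-- per certified universal rather than one per proof of certification.
record Atom : Set where
  constructor atom
  field
    body       : Term
    .certified : Certified body

-- Expressions for elements of the free Boolean algebra on the atoms,
-- which is Value modulo _≈_.
infixr 7 ¬ᵛ_
infixr 6 _∧ᵛ_
infixr 5 _∨ᵛ_

data Value : Set where
  𝕩         : Atom → Value
  ⊤ᵛ Fᵛ     : Value
  ¬ᵛ_       : Value → Value
  _∨ᵛ_ _∧ᵛ_ : Value → Value → Value

infix 4 _≈_
data _≈_ : Value → Value → Set where
  ≈-refl     : ∀ {p} → p ≈ p
  ≈-sym      : ∀ {p q} → p ≈ q → q ≈ p
  ≈-trans    : ∀ {p q r} → p ≈ q → q ≈ r → p ≈ r
  ¬-cong     : ∀ {p p′} → p ≈ p′ → ¬ᵛ p ≈ ¬ᵛ p′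
  ∨-cong     : ∀ {p p′ q q′} → p ≈ p′ → q ≈ q′ → p ∨ᵛ q ≈ p′ ∨ᵛ q′
  ∧-cong     : ∀ {p p′ q q′} → p ≈ p′ → q ≈ q′ → p ∧ᵛ q ≈ p′ ∧ᵛ q′
  ∨-comm     : ∀ p q → p ∨ᵛ q ≈ q ∨ᵛ p
  ∧-comm     : ∀ p q → p ∧ᵛ q ≈ q ∧ᵛ p
  ∨-assoc    : ∀ p q r → (p ∨ᵛ q) ∨ᵛ r ≈ p ∨ᵛ (q ∨ᵛ r)
  ∧-assoc    : ∀ p q r → (p ∧ᵛ q) ∧ᵛ r ≈ p ∧ᵛ (q ∧ᵛ r)
  ∨-absorb   : ∀ p q → p ∨ᵛ (p ∧ᵛ q) ≈ p
  ∧-absorb   : ∀ p q → p ∧ᵛ (p ∨ᵛ q) ≈ p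
  ∨-distribʳ : ∀ p q r → (q ∧ᵛ r) ∨ᵛ p ≈ (q ∨ᵛ p) ∧ᵛ (r ∨ᵛ p)
  ∨-compl    : ∀ p → p ∨ᵛ ¬ᵛ p ≈ ⊤ᵛ
  ∧-compl    : ∀ p → p ∧ᵛ ¬ᵛ p ≈ Fᵛ

freeBooleanAlgebra : BooleanAlgebra 0ℓ 0ℓ
freeBooleanAlgebra = record
  { Carrier = Value ; _≈_ = _≈_
  ; _∨_ = _∨ᵛ_ ; _∧_ = _∧ᵛ_ ; ¬_ = ¬ᵛ_ ; ⊤ = ⊤ᵛ ; ⊥ = Fᵛ
  ; isBooleanAlgebra = isBooleanAlgebraʳ record
    { isDistributiveLattice = isDistributiveLatticeʳʲᵐ record
      { isLattice = record
        { isEquivalence = record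
          { refl = ≈-refl ; sym = ≈-sym ; trans = ≈-trans }
        ; ∨-comm = ∨-comm ; ∨-assoc = ∨-assoc ; ∨-cong = ∨-cong
        ; ∧-comm = ∧-comm ; ∧-assoc = ∧-assoc ; ∧-cong = ∧-cong
        ; absorptive = ∨-absorb , ∧-absorb
        }
      ; ∨-distribʳ-∧ = ∨-distribʳ
      }
    ; ∨-complementʳ = ∨-compl
    ; ∧-complementʳ = ∧-compl
    ; ¬-cong = ¬-cong
    }
  }

infix 3 _⇝_
data _⇝_ : Term → Value → Set where
  -- Values are taken modulo _≈_.
  ev-≈ : ∀ {φ p q} → p ≈ q → φ ⇝ p → φ ⇝ q
  ev-⊤ : ∀ {φ} → [] ⊢ᴼ φ → φ ⇝ ⊤ᵛ
  ev-F : ∀ {φ} → [] ⊢ᴼ ~ φ → φ ⇝ Fᵛ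
  ev-~ : ∀ {φ p} → φ ⇝ p → ~ φ ⇝ ¬ᵛ p
  ev-⋎ : ∀ {φ ψ p q} → φ ⇝ p → ψ ⇝ q → φ ⋎ ψ ⇝ p ∨ᵛ q
  ev-𝓐 : ∀ {u} (κ : Certified u) → 𝓐 · u ⇝ 𝕩 (atom u κ)

------------------------------------------------------------------------
-- Valuations and super-truth

Valuation : Set
Valuation = Atom → Bool

⟦_⟧ : Value → Valuation → Bool
⟦ 𝕩 x ⟧    w = w x
⟦ ⊤ᵛ ⟧     w = true
⟦ Fᵛ ⟧     w = false
⟦ ¬ᵛ p ⟧   w = not (⟦ p ⟧ w)
⟦ p ∨ᵛ q ⟧ w = ⟦ p ⟧ w ∨ ⟦ q ⟧ w
⟦ p ∧ᵛ q ⟧ w = ⟦ p ⟧ w ∧ ⟦ q ⟧ w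

-- ⟦_⟧ is well defined on the free Boolean algebra.
⟦⟧-cong : ∀ {p q} → p ≈ q → ∀ w → ⟦ p ⟧ w ≡ ⟦ q ⟧ w
⟦⟧-cong ≈-refl             w = refl
⟦⟧-cong (≈-sym e)          w = sym (⟦⟧-cong e w)
⟦⟧-cong (≈-trans e e′)     w = trans (⟦⟧-cong e w) (⟦⟧-cong e′ w)
⟦⟧-cong (¬-cong e)         w = cong not (⟦⟧-cong e w)
⟦⟧-cong (∨-cong e e′)      w = cong₂ _∨_ (⟦⟧-cong e w) (⟦⟧-cong e′ w)
⟦⟧-cong (∧-cong e e′)      w = cong₂ _∧_ (⟦⟧-cong e w) (⟦⟧-cong e′ w)
⟦⟧-cong (∨-comm p q)       w = Bool.∨-comm (⟦ p ⟧ w) (⟦ q ⟧ w)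
⟦⟧-cong (∧-comm p q)       w = Bool.∧-comm (⟦ p ⟧ w) (⟦ q ⟧ w)
⟦⟧-cong (∨-assoc p q r)    w = Bool.∨-assoc (⟦ p ⟧ w) (⟦ q ⟧ w) (⟦ r ⟧ w)
⟦⟧-cong (∧-assoc p q r)    w = Bool.∧-assoc (⟦ p ⟧ w) (⟦ q ⟧ w) (⟦ r ⟧ w)
⟦⟧-cong (∨-absorb p q)     w = Bool.∨-abs-∧ (⟦ p ⟧ w) (⟦ q ⟧ w)
⟦⟧-cong (∧-absorb p q)     w = Bool.∧-abs-∨ (⟦ p ⟧ w) (⟦ q ⟧ w)
⟦⟧-cong (∨-distribʳ p q r) w =
  Bool.∨-distribʳ-∧ (⟦ p ⟧ w) (⟦ q ⟧ w) (⟦ r ⟧ w)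
⟦⟧-cong (∨-compl p)        w = Bool.∨-inverseʳ (⟦ p ⟧ w)
⟦⟧-cong (∧-compl p)        w = Bool.∧-inverseʳ (⟦ p ⟧ w)

data HonestMember (w : Valuation) : Term → Set where
  pos : ∀ {u} (κ : Certified u) → w (atom u κ) ≡ true → HonestMember w (𝓐 · u)
  neg : ∀ {u} (κ : Certified u) → w (atom u κ) ≡ false → HonestMember w (~ (𝓐 · u))

Honest : Valuation → Ctx → Set
Honest w = All (HonestMember w)

Admissible : Valuation → Set
Admissible w = ∀ Δ → Honest w Δ → ¬ (∃[ c ] (Δ ⊢ᴼ c) × (Δ ⊢ᴼ ~ c))

SuperTrue : Term → Set
SuperTrue φ = ∃[ p ] (φ ⇝ p) × (∀ w → Admissible w → ⟦ p ⟧ w ≡ true)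

{-# OPTIONS --safe #-}
-- Every evaluated φ is boolean, ⊢ φ 𝖡, where ATI supplies the case of
-- certified universals.  So if ⊬ φ, then ~ φ is consistent, and since there
-- are countably many terms it extends to a consistent theory that decides
-- every boolean term.  The truth values that this theory gives to the
-- certified universals form an admissible valuation, under which any value
-- of φ agrees with what the theory says about φ and is therefore false.
module Submission where

open import Defs
open import Axiom.ExcludedMiddle using (ExcludedMiddle)
open import Data.Bool.Base using (Bool; true; false; if_then_else_)
open import Data.List.Base using (List; []; _∷_; _++_; map; concat; foldr; cartesianProductWith)
open import Data.List.Membership.Propositional using (_∈_)
open import Data.List.Membership.Propositional.Properties
  using (∈-++⁺ˡ; ∈-++⁺ʳ; ∈-++⁻; ∈-map⁺; ∈-concat⁺′; ∈-cartesianProductWith⁺)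
open import Data.List.Relation.Binary.Subset.Propositional using (_⊆_)
open import Data.List.Relation.Binary.Subset.Propositional.Properties
  using (xs⊆xs++ys; xs⊆ys++xs; ∷⁺ʳ)
open import Data.List.Relation.Unary.All as All using (All; []; _∷_)
open import Data.List.Relation.Unary.Any using (here; there)
open import Data.Nat.Base using (ℕ; zero; suc; _≤_; _⊔_; _≤′_; ≤′-reflexive; ≤′-step)
open import Data.Nat.Properties using (≤⇒≤′; m≤m⊔n; m≤n⊔m)
open import Data.Product.Base using (∃-syntax; _×_; _,_)
open import Data.Sum.Base as Sum using (_⊎_; inj₁; inj₂; [_,_]′)
open import Function.Base using (id; _∘_)
open import Function.Bundles using (_⇔_; mk⇔)
open import Level using (0ℓ)
open import Relation.Binary.PropositionalEquality as ≡ using (refl)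
open import Relation.Nullary.Decidable.Core using (does; yes; no)
open import Relation.Nullary.Negation.Core using (¬_; contradiction)

private variable
  R : Rules
  j : Judgment
  js π π′ : List Judgment
  Γ Δ : Ctx
  a c t u φ : Term
  p : Value
  m n : ℕ

-- Admissible structural rules

proof-++ : Proof R π → Proof R π′ → Proof R (π ++ π′)
proof-++ []                q = q
proof-++ (step p premises r) q =
  step (proof-++ p q) (All.map ∈-++⁺ˡ premises) r

-- A rule needs all its premises in one list, so the separate proofs are concatenated first.
derive : All (Derivable R) js → R js j → Derivable R j
derive {R = R} ds r with collect ds
  where
  collect : ∀ {js} → All (Derivable R) js →
            ∃[ π ] Proof R π × All (_∈ π) js
  collect [] = [] , [] , []
  collect ((π , p , j∈π) ∷ ds) with collect ds
  ... | π′ , q , js⊆π′ =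
    π ++ π′ , proof-++ p q , ∈-++⁺ˡ j∈π ∷ All.map (∈-++⁺ʳ π) js⊆π′
... | π , p , js⊆π = _ , step p js⊆π r , here refl

infer : All (Derivable OGA) js → RGA js j → Derivable OGA j
infer ds r = derive ds (rga r)

assumption : c ∷ Γ ⊢ᴼ c
assumption = infer [] hyp

weakening : Γ ⊆ Δ → Γ ⊢ᴼ c → Δ ⊢ᴼ c
weakening {Γ} {Δ} {c} Γ⊆Δ d =
  -- Since `Γ ⊆ Δ`, the lists `Δ ++ Γ` and `Δ` have the same members.
  infer (prepend Δ ∷ []) (reset (mk⇔ ([ id , Γ⊆Δ ]′ ∘ ∈-++⁻ Δ) ∈-++⁺ˡ))
  where
  prepend : ∀ Δ → Δ ++ Γ ⊢ᴼ c
  prepend []      = d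
  prepend (_ ∷ Δ) = infer (prepend Δ ∷ []) weaken

∈⇒⊢ : c ∈ Γ → Γ ⊢ᴼ c
∈⇒⊢ c∈Γ = weakening (λ { (here refl) → c∈Γ }) (assumption {Γ = []})

-- In the context `Δ ++ Γ` the members of `Δ` can be cut one by one from the front.
cuts : All (Γ ⊢ᴼ_) Δ → Δ ⊢ᴼ c → Γ ⊢ᴼ c
cuts {Γ} ds d = go ds (weakening (xs⊆xs++ys _ Γ) d)
  where
  go : ∀ {Δ c} → All (Γ ⊢ᴼ_) Δ → Δ ++ Γ ⊢ᴼ c → Γ ⊢ᴼ c
  go []       e = e
  go (d ∷ ds) e = go ds (infer (weakening (xs⊆ys++xs Γ _) d ∷ e ∷ []) cut)

-- Boolean terms

Boolean : Term → Set
Boolean t = [] ⊢ᴼ t 𝖡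

-- There is no rule of excluded middle, so classical case distinction on `t` is paid for by a proof
-- of `t 𝖡`.
boolean-cases : Boolean t → t ∷ Γ ⊢ᴼ c → ~ t ∷ Γ ⊢ᴼ c → Γ ⊢ᴼ c
boolean-cases β d e = infer (weakening (λ ()) β ∷ d ∷ e ∷ []) ⋎-E

~-boolean : Boolean t → Boolean (~ t)
~-boolean β = boolean-cases β
  (infer (infer (assumption ∷ []) ~~-I ∷ []) ⋎-I₂)
  (infer (assumption ∷ []) ⋎-I₁)

⋎-boolean : Boolean t → Boolean u → Boolean (t ⋎ u)
⋎-boolean β γ = boolean-cases β
  (infer (infer (assumption ∷ []) ⋎-I₁ ∷ []) ⋎-I₁)
  (boolean-cases γ
    (infer (infer (assumption ∷ []) ⋎-I₂ ∷ []) ⋎-I₁)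
    (infer (infer (∈⇒⊢ (there (here refl)) ∷ assumption ∷ []) ~⋎-I ∷ []) ⋎-I₂))

⇝-boolean : φ ⇝ p → Boolean φ
⇝-boolean (ev-≈ _ e)  = ⇝-boolean e
⇝-boolean (ev-⊤ d)    = infer (d ∷ []) ⋎-I₁
⇝-boolean (ev-F d)    = infer (d ∷ []) ⋎-I₂
⇝-boolean (ev-~ e)    = ~-boolean (⇝-boolean e)
⇝-boolean (ev-⋎ e e′) = ⋎-boolean (⇝-boolean e) (⇝-boolean e′)
⇝-boolean (ev-𝓐 κ)    = derive (κ ∷ []) ATI

Inconsistent : Ctx → Set
Inconsistent Γ = ∃[ c ] (Γ ⊢ᴼ c) × (Γ ⊢ᴼ ~ c)

inconsistent-⊢ : Inconsistent Γ → Γ ⊢ᴼ a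
inconsistent-⊢ (_ , d , e) = infer (e ∷ d ∷ []) ~-E

inconsistent-⊆ : Γ ⊆ Δ → Inconsistent Γ → Inconsistent Δ
inconsistent-⊆ Γ⊆Δ (c , d , e) = c , weakening Γ⊆Δ d , weakening Γ⊆Δ e

-- Enumeration of the terms

built : ℕ → List Term → List (List Term)
built n ts =
    (v n ∷ bot ∷ 𝟎 ∷ 𝓡 ∷ 𝓐 ∷ [])
  ∷ map 𝐒_ ts
  ∷ map ~_ ts
  ∷ map ƛ_ ts
  ∷ cartesianProductWith _≐_ ts ts
  ∷ cartesianProductWith _⋎_ ts ts
  ∷ cartesianProductWith _·_ ts ts
  ∷ []

-- Admitting one new variable per stage keeps every stage finite, yet each index is reached.
terms : ℕ → List Term
terms zero    = []
terms (suc n) = terms n ++ concat (built n (terms n))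

⊆-ascending : (f : ℕ → List Term) → (∀ n → f n ⊆ f (suc n)) → m ≤ n → f m ⊆ f n
⊆-ascending f f-step = go ∘ ≤⇒≤′
  where
  go : ∀ {m n} → m ≤′ n → f m ⊆ f n
  go (≤′-reflexive refl) = id
  go (≤′-step m≤n)       = f-step _ ∘ go m≤n

terms-mono : m ≤ n → terms m ⊆ terms n
terms-mono = ⊆-ascending terms (λ _ → ∈-++⁺ˡ)

∈-terms-suc : ∀ n {t ts} → t ∈ ts → ts ∈ built n (terms n) → t ∈ terms (suc n)
∈-terms-suc n t∈ts ts∈tss = ∈-++⁺ʳ (terms n) (∈-concat⁺′ t∈ts ts∈tss)

common-stage : ∀ {t u} → ∃[ m ] t ∈ terms m → ∃[ n ] u ∈ terms n →
               ∃[ n ] t ∈ terms n × u ∈ terms n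
common-stage (m , t∈) (n , u∈) =
  m ⊔ n , terms-mono (m≤m⊔n m n) t∈ , terms-mono (m≤n⊔m m n) u∈

∈-terms : ∀ t → ∃[ n ] t ∈ terms n
∈-terms (v i) = suc i , ∈-terms-suc i (here refl) (here refl)
∈-terms bot   = 1 , there (here refl)
∈-terms 𝟎     = 1 , there (there (here refl))
∈-terms 𝓡     = 1 , there (there (there (here refl)))
∈-terms 𝓐     = 1 , there (there (there (there (here refl))))
∈-terms (𝐒 t) with ∈-terms t
... | n , t∈ = suc n , ∈-terms-suc n (∈-map⁺ 𝐒_ t∈) (there (here refl))
∈-terms (~ t) with ∈-terms t
... | n , t∈ = suc n , ∈-terms-suc n (∈-map⁺ ~_ t∈) (there (there (here refl)))
∈-terms (ƛ t) with ∈-terms t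
... | n , t∈ = suc n , ∈-terms-suc n (∈-map⁺ ƛ_ t∈) (there (there (there (here refl))))
∈-terms (t ≐ u) with common-stage (∈-terms t) (∈-terms u)
... | n , t∈ , u∈ = suc n , ∈-terms-suc n (∈-cartesianProductWith⁺ _≐_ t∈ u∈)
  (there (there (there (there (here refl)))))
∈-terms (t ⋎ u) with common-stage (∈-terms t) (∈-terms u)
... | n , t∈ , u∈ = suc n , ∈-terms-suc n (∈-cartesianProductWith⁺ _⋎_ t∈ u∈)
  (there (there (there (there (there (here refl))))))
∈-terms (t · u) with common-stage (∈-terms t) (∈-terms u)
... | n , t∈ , u∈ = suc n , ∈-terms-suc n (∈-cartesianProductWith⁺ _·_ t∈ u∈)
  (there (there (there (there (there (there (here refl)))))))

module _ (em : ExcludedMiddle 0ℓ) where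

  -- Lindenbaum completion

  adjoin : Term → Ctx → Ctx
  adjoin t Γ = if does (em {Inconsistent (t ∷ Γ)}) then Γ else t ∷ Γ

  ⊆-adjoin : ∀ t → Γ ⊆ adjoin t Γ
  ⊆-adjoin {Γ} t with em {Inconsistent (t ∷ Γ)}
  ... | yes _ = id
  ... | no  _ = there

  adjoin-consistent : ∀ t → ¬ Inconsistent Γ → ¬ Inconsistent (adjoin t Γ)
  adjoin-consistent {Γ} t con with em {Inconsistent (t ∷ Γ)}
  ... | yes _    = con
  ... | no  con′ = con′

  adjoin-decides : ∀ t → t ∈ adjoin t Γ ⊎ Inconsistent (t ∷ Γ)
  adjoin-decides {Γ} t with em {Inconsistent (t ∷ Γ)}
  ... | yes inc = inj₂ inc
  ... | no  _   = inj₁ (here refl)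

  extend : List Term → Ctx → Ctx
  extend ts Γ = foldr adjoin Γ ts

  ⊆-extend : ∀ ts → Γ ⊆ extend ts Γ
  ⊆-extend []       = id
  ⊆-extend (t ∷ ts) = ⊆-adjoin t ∘ ⊆-extend ts

  extend-consistent : ∀ ts → ¬ Inconsistent Γ → ¬ Inconsistent (extend ts Γ)
  extend-consistent []       = id
  extend-consistent (t ∷ ts) = adjoin-consistent t ∘ extend-consistent ts

  -- A term once refused stays inconsistent with every larger context, so later additions cannot
  -- undo a decision.
  extend-decides : ∀ ts → t ∈ ts → t ∈ extend ts Γ ⊎ Inconsistent (t ∷ extend ts Γ)
  extend-decides (t ∷ ts) (here refl) =
    Sum.map₂ (inconsistent-⊆ (∷⁺ʳ t (⊆-adjoin t))) (adjoin-decides t)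
  extend-decides (t ∷ ts) (there t∈ts) =
    Sum.map (⊆-adjoin t) (inconsistent-⊆ (∷⁺ʳ _ (⊆-adjoin t))) (extend-decides ts t∈ts)

  module Completion (Γ : Ctx) (consistent : ¬ Inconsistent Γ) where

    stage : ℕ → Ctx
    stage zero    = Γ
    stage (suc n) = extend (terms n) (stage n)

    stage-mono : m ≤ n → stage m ⊆ stage n
    stage-mono = ⊆-ascending stage (λ n → ⊆-extend (terms n))

    stage-consistent : ∀ n → ¬ Inconsistent (stage n)
    stage-consistent zero    = consistent
    stage-consistent (suc n) = extend-consistent (terms n) (stage-consistent n)

    -- The completed theory is the union of all stages. Contexts are finite, so derivability from it
    -- is derivability from some stage.
    Theorem : Term → Set
    Theorem t = ∃[ n ] (stage n ⊢ᴼ t)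

    finite-stage : All Theorem Δ → ∃[ n ] All (stage n ⊢ᴼ_) Δ
    finite-stage [] = 0 , []
    finite-stage ((m , d) ∷ ds) with finite-stage ds
    ... | n , ds′ = m ⊔ n
      , weakening (stage-mono (m≤m⊔n m n)) d
      ∷ All.map (weakening (stage-mono (m≤n⊔m m n))) ds′

    theorem-closed : All Theorem Δ → Δ ⊢ᴼ c → Theorem c
    theorem-closed ts d with finite-stage ts
    ... | n , ds = n , cuts ds d

    -- Finitely many theorems are derivable at a common stage, which would inherit the
    -- contradiction.
    theorem-consistent : All Theorem Δ → ¬ Inconsistent Δ
    theorem-consistent ts (c , d , e) with finite-stage ts
    ... | n , ds = stage-consistent n (c , cuts ds d , cuts ds e)

    theorem-complete : Boolean t → Theorem t ⊎ Theorem (~ t)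
    theorem-complete {t} β with ∈-terms t
    ... | n , t∈ with extend-decides {Γ = stage n} (terms n) t∈
    ... | inj₁ t∈stage = inj₁ (suc n , ∈⇒⊢ t∈stage)
    ... | inj₂ inc     =
      -- A refused `t` entails everything, in particular `~ t`; as `t` is boolean, `~ t` follows
      -- outright.
      inj₂ (suc n , boolean-cases β (inconsistent-⊢ inc) assumption)

    -- The valuation of the completion

    literal : Bool → Term → Term
    literal b t = if b then t else ~ t

    valuation : Valuation
    valuation x = does (em {Theorem (𝓐 · Atom.body x)})

    -- By `ATI` a certified universal is boolean, so the completion proves its negation if it does
    -- not prove the universal itself.
    valuation-literal : (κ : Certified u) →
                        Theorem (literal (valuation (atom u κ)) (𝓐 · u))
    valuation-literal {u} κ with em {Theorem (𝓐 · u)}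
    ... | yes d = d
    ... | no ¬d with theorem-complete (derive (κ ∷ []) ATI)
    ...   | inj₁ d = contradiction d ¬d
    ...   | inj₂ d = d

    -- Members of an honest set are literals chosen by `valuation`, hence theorems of a consistent
    -- theory.
    valuation-admissible : Admissible valuation
    valuation-admissible Δ honest = theorem-consistent (All.map member honest)
      where
      member : HonestMember valuation t → Theorem t
      member (pos κ eq) = ≡.subst (λ b → Theorem (literal b _)) eq (valuation-literal κ)
      member (neg κ eq) = ≡.subst (λ b → Theorem (literal b _)) eq (valuation-literal κ)

    -- The truth lemma, by induction on the evaluation rather than on `φ`, which may have several
    -- values.
    ⇝-literal : φ ⇝ p → Theorem (literal (⟦ p ⟧ valuation) φ)
    ⇝-literal {φ} (ev-≈ p≈q e) =
      ≡.subst (λ b → Theorem (literal b φ)) (⟦⟧-cong p≈q valuation) (⇝-literal e)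
    ⇝-literal (ev-⊤ d) = theorem-closed [] d
    ⇝-literal (ev-F d) = theorem-closed [] d
    ⇝-literal (ev-~ {p = p} e) with ⟦ p ⟧ valuation | ⇝-literal e
    ... | true  | d = theorem-closed (d ∷ []) (infer (assumption ∷ []) ~~-I)
    ... | false | d = d
    ⇝-literal (ev-⋎ {p = p} {q} e e′)
      with ⟦ p ⟧ valuation | ⇝-literal e | ⟦ q ⟧ valuation | ⇝-literal e′
    ... | true  | d | _     | _  = theorem-closed (d ∷ []) (infer (assumption ∷ []) ⋎-I₁)
    ... | false | _ | true  | d′ = theorem-closed (d′ ∷ []) (infer (assumption ∷ []) ⋎-I₂)
    ... | false | d | false | d′ = theorem-closed (d ∷ d′ ∷ [])
      (infer (assumption ∷ ∈⇒⊢ (there (here refl)) ∷ []) ~⋎-I)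
    ⇝-literal (ev-𝓐 κ) = valuation-literal κ

  -- Derivability and super-truth

  superTrue⇒⊢ : SuperTrue φ → [] ⊢ᴼ φ
  superTrue⇒⊢ {φ} (p , e , true-everywhere) with em {Inconsistent (~ φ ∷ [])}
  -- Having a value makes `φ` boolean, so refuting `~ φ` is enough to derive `φ`.
  ... | yes inc       = boolean-cases (⇝-boolean e) assumption (inconsistent-⊢ inc)
  ... | no consistent = contradiction (φ , assumption , ∈⇒⊢ (there (here refl)))
    -- `~ φ` is a theorem already at stage 0, where the completion starts.
    (theorem-consistent (φ-theorem ∷ (0 , assumption) ∷ []))
    where
    open Completion (~ φ ∷ []) consistent
    φ-theorem : Theorem φ
    φ-theorem = ≡.subst (λ b → Theorem (literal b φ))
      (true-everywhere valuation valuation-admissible) (⇝-literal e)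

⊢⇒superTrue : [] ⊢ᴼ φ → SuperTrue φ
⊢⇒superTrue d = ⊤ᵛ , ev-⊤ d , λ _ _ → refl

theorem4p2 : ExcludedMiddle 0ℓ → ∀ (φ : Term) → ([] ⊢ᴼ φ) ⇔ SuperTrue φ
theorem4p2 em φ = mk⇔ ⊢⇒superTrue (superTrue⇒⊢ em)
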